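{- Suppose $\mathcal D=(\mathcal P,\mathcal B,\mathcal I)$ is a non-trivial $G$-pairwise transitive $2$-design, where $G\le\mathrm{Aut}(\mathcal D)$, $G^{\mathcal P}$ is of almost simple type, and $G^{\mathcal B}$ is imprimitive of rank $3$, with (nontrivial) system of imprimitivity $\mathcal S$ on $\mathcal B$. Then the two actions $G^{\mathcal P}$ and $G^{\mathcal S}$ are not the point and hyperplane actions of a projective linear group; that is, there are no $a\ge3$ and prime power $q$ such that $G$ has socle $\mathrm{PSL}(a,q)$ with $G$ acting on $\mathcal P$ as on the points, and on $\mathcal S$ as on the hyperplanes, of $\mathrm{PG}(a-1,q)$.
   Context: A design $\mathcal D=(\mathcal P,\mathcal B,\mathcal I)$ consists of finite sets $\mathcal P$ (points), $\mathcal B$ (blocks) and an incidence relation $\mathcal I\subseteq\mathcal P\times\mathcal B$. It is a $2$-$(v,k,\lambda)$ design (or $2$-design) if $|\mathcal P|=v$, each block is incident with exactly $k$ points, and each pair of distinct points is incident with exactly $\lambda$ common blocks. It is non-trivial if $2<k<v$. An automorphism is a permutation of $\mathcal P\cup\mathcal B$ leaving $\mathcal P$ and $\mathcal B$ invariant setwise and preserving incidence; $\mathrm{Aut}(\mathcal D)$ is the group of all automorphisms. Two blocks are intersecting if some point is incident with both. For $G\le\mathrm{Aut}(\mathcal D)$, the $2$-design $\mathcal D$ is $G$-pairwise transitive if $G$ is transitive on each of the following five (possibly empty) sets of ordered pairs: pairs of distinct points, incident point-block pairs, non-incident point-block pairs, pairs of distinct intersecting blocks, pairs of non-intersecting blocks.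 $G^{X}$ denotes the permutation group induced by $G$ on $X$. A transitive permutation group has rank $n$ if a point stabiliser has exactly $n$ orbits. A permutation group is of almost simple type if it is an almost simple group. A system of imprimitivity is a $G$-invariant partition; it is nontrivial if its parts are neither singletons nor the whole set (for an imprimitive rank $3$ group it is unique). -}

module Defs where

open import Algebra.Apartness.Bundles using (HeytingField; HeytingCommutativeRing)
open import Algebra.Bundles using (Group; Semiring; CommutativeRing)
import Algebra.Construct.DirectProduct as DirectProduct
import Algebra.Definitions.RawSemiring as RawSemiringDefinitions
open import Algebra.Morphism.Structures using (IsGroupHomomorphism; IsGroupMonomorphism; IsRingHomomorphism)
import Algebra.Properties.Group as GroupProperties
import Algebra.Properties.Semiring.Sum as SemiringSum
open import Data.Fin.Base using (Fin; zero; suc; toℕ; punchIn)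
import Data.Fin.Properties as Fin
open import Data.Nat.Base using (ℕ; zero; suc; _∸_; _^_; NonZero)
open import Data.Nat.Primality using (Prime)
open import Data.Product.Base using (Σ; Σ-syntax; ∃; ∃-syntax; _×_; _,_; proj₁; proj₂)
open import Data.Vec.Base using (count; allFin)
open import Data.Vec.Functional using (Vector)
import Data.Vec.Functional.Relation.Binary.Equality.Setoid as Pointwise
open import Function.Base using (_∘_)
open import Function.Bundles using (Inverse; _⇔_; mk⇔; Equivalence)
import Function.Construct.Composition as Composition
import Function.Construct.Identity as Identity
import Function.Construct.Symmetry as Symmetry
open import Level using (0ℓ) renaming (suc to lsuc)
open import Relation.Binary.Bundles using (Setoid)
open import Relation.Binary.Core using (Rel; REL)
open import Relation.Binary.Definitions using (Decidable)
open import Relation.Binary.PropositionalEquality as ≡ using (_≡_; _≢_)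
import Relation.Binary.Reasoning.Setoid as SetoidReasoning
open import Relation.Binary.Structures using (IsEquivalence)
open import Relation.Nullary.Decidable using (yes; no; _×-dec_)
open import Relation.Nullary.Negation using (¬_)
open import Relation.Unary using (Pred; _∈_; _⊆_; _≐_)

-- Every finite group has a copy in the lowest universe, so fixing it loses nothing.
Grp : Set₁
Grp = Group 0ℓ 0ℓ

record Subgroup (G : Grp) : Set₁ where
  open Group G
  field
    member    : Pred Carrier 0ℓ
    ≈-closed  : ∀ {x y} → x ≈ y → x ∈ member → y ∈ member
    ε-closed  : ε ∈ member
    ∙-closed  : ∀ {x y} → x ∈ member → y ∈ member → (x ∙ y) ∈ member
    ⁻¹-closed : ∀ {x} → x ∈ member → (x ⁻¹) ∈ member

  group : Grp
  group = record
    { Carrier = Σ Carrier member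
    ; _≈_     = λ x y → proj₁ x ≈ proj₁ y
    ; _∙_     = λ x y → proj₁ x ∙ proj₁ y , ∙-closed (proj₂ x) (proj₂ y)
    ; ε       = ε , ε-closed
    ; _⁻¹     = λ x → proj₁ x ⁻¹ , ⁻¹-closed (proj₂ x)
    ; isGroup = record
      { isMonoid = record
        { isSemigroup = record
          { isMagma = record
            { isEquivalence = record { refl = refl ; sym = sym ; trans = trans }
            ; ∙-cong        = ∙-cong
            }
          ; assoc = λ x y z → assoc (proj₁ x) (proj₁ y) (proj₁ z)
          }
        ; identity = (λ x → identityˡ (proj₁ x)) , (λ x → identityʳ (proj₁ x))
        }
      ; inverse = (λ x → inverseˡ (proj₁ x)) , (λ x → inverseʳ (proj₁ x))
      ; ⁻¹-cong = ⁻¹-cong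
      }
    }

open Subgroup using (member)

module _ {G : Grp} where
  open Group G

  IsNormal : Subgroup G → Set
  IsNormal N = ∀ g {x} → x ∈ member N → (g ∙ x ∙ g ⁻¹) ∈ member N

  IsNontrivial : Subgroup G → Set
  IsNontrivial N = ∃[ x ] (x ∈ member N × ¬ x ≈ ε)

  -- Non-triviality is phrased positively: "N = 1 or N = M" is not provable
  -- for an arbitrary predicate N, whereas "N ≠ 1 implies N = M" is.
  IsMinimalNormal : Subgroup G → Set₁
  IsMinimalNormal N = IsNormal N × IsNontrivial N ×
    (∀ (M : Subgroup G) → IsNormal M → IsNontrivial M → member M ⊆ member N → member N ⊆ member M)

module _ (G : Grp) where
  open Group G

  data Generated {ℓ} (S : Pred Carrier ℓ) : Pred Carrier ℓ where
    generator : ∀ {x} → x ∈ S → Generated S x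
    by-≈      : ∀ {x y} → x ≈ y → Generated S x → Generated S y
    by-ε      : Generated S ε
    by-∙      : ∀ {x y} → Generated S x → Generated S y → Generated S (x ∙ y)
    by-⁻¹     : ∀ {x} → Generated S x → Generated S (x ⁻¹)

  Socle : Pred Carrier (lsuc 0ℓ)
  Socle = Generated (λ x → Σ[ N ∈ Subgroup G ] (IsMinimalNormal N × x ∈ member N))

  IsSimple : Set₁
  IsSimple = (∃[ x ] ¬ x ≈ ε) ×
    (∀ (N : Subgroup G) → IsNormal N → IsNontrivial N → ∀ x → x ∈ member N)

  IsNonabelian : Set
  IsNonabelian = ∃[ x ] ∃[ y ] ¬ x ∙ y ≈ y ∙ x

module _ (G : Grp) (N : Subgroup G) (N-normal : IsNormal N) where
  open Group G
  open Subgroup N using (≈-closed; ε-closed; ∙-closed; ⁻¹-closed)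
  open GroupProperties G
  open SetoidReasoning setoid

  private
    infix 4 _≈ₙ_
    _≈ₙ_ : Rel Carrier 0ℓ
    x ≈ₙ y = (x ∙ y ⁻¹) ∈ member N

    fromEq : ∀ {x y} → x ≈ y → x ≈ₙ y
    fromEq {x} {y} x≈y = ≈-closed (trans (sym (inverseʳ y)) (∙-congʳ (sym x≈y))) ε-closed

    cancelMiddle : ∀ x y z → (x ∙ y ⁻¹) ∙ (y ∙ z) ≈ x ∙ z
    cancelMiddle x y z = begin
      (x ∙ y ⁻¹) ∙ (y ∙ z) ≈⟨ assoc x (y ⁻¹) (y ∙ z) ⟩
      x ∙ (y ⁻¹ ∙ (y ∙ z)) ≈⟨ ∙-congˡ (assoc (y ⁻¹) y z) ⟨
      x ∙ ((y ⁻¹ ∙ y) ∙ z) ≈⟨ ∙-congˡ (∙-congʳ (inverseˡ y)) ⟩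
      x ∙ (ε ∙ z)          ≈⟨ ∙-congˡ (identityˡ z) ⟩
      x ∙ z                ∎

    symₙ : ∀ {x y} → x ≈ₙ y → y ≈ₙ x
    symₙ {x} {y} p = ≈-closed (trans (⁻¹-anti-homo-∙ x (y ⁻¹)) (∙-congʳ (⁻¹-involutive y))) (⁻¹-closed p)

    transₙ : ∀ {x y z} → x ≈ₙ y → y ≈ₙ z → x ≈ₙ z
    transₙ {x} {y} {z} p q = ≈-closed (cancelMiddle x y (z ⁻¹)) (∙-closed p q)

    congₙ : ∀ {x y u v} → x ≈ₙ y → u ≈ₙ v → x ∙ u ≈ₙ y ∙ v
    congₙ {x} {y} {u} {v} p q = ≈-closed eq (∙-closed (N-normal x q) p)
      where
      eq : (x ∙ (u ∙ v ⁻¹) ∙ x ⁻¹) ∙ (x ∙ y ⁻¹) ≈ (x ∙ u) ∙ (y ∙ v) ⁻¹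
      eq = begin
        (x ∙ (u ∙ v ⁻¹) ∙ x ⁻¹) ∙ (x ∙ y ⁻¹) ≈⟨ cancelMiddle _ x (y ⁻¹) ⟩
        (x ∙ (u ∙ v ⁻¹)) ∙ y ⁻¹              ≈⟨ ∙-congʳ (assoc x u (v ⁻¹)) ⟨
        ((x ∙ u) ∙ v ⁻¹) ∙ y ⁻¹              ≈⟨ assoc (x ∙ u) (v ⁻¹) (y ⁻¹) ⟩
        (x ∙ u) ∙ (v ⁻¹ ∙ y ⁻¹)              ≈⟨ ∙-congˡ (⁻¹-anti-homo-∙ y v) ⟨
        (x ∙ u) ∙ (y ∙ v) ⁻¹                 ∎

    inverse-congₙ : ∀ {x y} → x ≈ₙ y → x ⁻¹ ≈ₙ y ⁻¹
    inverse-congₙ {x} {y} p = ≈-closed eq (N-normal (x ⁻¹) (symₙ p))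
      where
      eq : (x ⁻¹ ∙ (y ∙ x ⁻¹)) ∙ (x ⁻¹) ⁻¹ ≈ x ⁻¹ ∙ (y ⁻¹) ⁻¹
      eq = begin
        (x ⁻¹ ∙ (y ∙ x ⁻¹)) ∙ (x ⁻¹) ⁻¹ ≈⟨ ∙-congʳ (assoc (x ⁻¹) y (x ⁻¹)) ⟨
        ((x ⁻¹ ∙ y) ∙ x ⁻¹) ∙ (x ⁻¹) ⁻¹ ≈⟨ assoc (x ⁻¹ ∙ y) (x ⁻¹) ((x ⁻¹) ⁻¹) ⟩
        (x ⁻¹ ∙ y) ∙ (x ⁻¹ ∙ (x ⁻¹) ⁻¹) ≈⟨ ∙-congˡ (inverseʳ (x ⁻¹)) ⟩
        (x ⁻¹ ∙ y) ∙ ε                  ≈⟨ identityʳ _ ⟩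
        x ⁻¹ ∙ y                        ≈⟨ ∙-congˡ (⁻¹-involutive y) ⟨
        x ⁻¹ ∙ (y ⁻¹) ⁻¹                ∎

  -- G / N, with the same carrier as G.
  quotient : Grp
  quotient = record
    { Carrier = Carrier
    ; _≈_     = λ x y → (x ∙ y ⁻¹) ∈ member N
    ; _∙_     = _∙_
    ; ε       = ε
    ; _⁻¹     = _⁻¹
    ; isGroup = record
      { isMonoid = record
        { isSemigroup = record
          { isMagma = record
            { isEquivalence = record { refl = fromEq refl ; sym = symₙ ; trans = transₙ }
            ; ∙-cong        = congₙ
            }
          ; assoc = λ x y z → fromEq (assoc x y z)
          }
        ; identity = (λ x → fromEq (identityˡ x)) , (λ x → fromEq (identityʳ x))
        }
      ; inverse = (λ x → fromEq (inverseˡ x)) , (λ x → fromEq (inverseʳ x))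
      ; ⁻¹-cong = inverse-congₙ
      }
    }

-- Products compose right to left: (f ∙ g) x = f (g x).
Sym : Setoid 0ℓ 0ℓ → Grp
Sym X = record
  { Carrier = Inverse X X
  ; _≈_     = λ f g → ∀ x → to f x ≈ to g x
  ; _∙_     = λ f g → Composition.inverse g f
  ; ε       = Identity.inverse X
  ; _⁻¹     = Symmetry.inverse
  ; isGroup = record
    { isMonoid = record
      { isSemigroup = record
        { isMagma = record
          { isEquivalence = record
            { refl  = λ _ → refl
            ; sym   = λ p x → sym (p x)
            ; trans = λ p q x → trans (p x) (q x)
            }
          ; ∙-cong = λ {f} {g} {h} {k} p q x → trans (to-cong f (q x)) (p (to k x))
          }
        ; assoc = λ _ _ _ _ → refl
        }
      ; identity = (λ _ _ → refl) , (λ _ _ → refl)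
      }
    ; inverse = strictlyInverseʳ , strictlyInverseˡ
    ; ⁻¹-cong = λ {f} {g} p x →
        inverseʳ f (trans (sym (strictlyInverseˡ g x)) (sym (p (from g x))))
    }
  }
  where
  open Setoid X
  open Inverse

AutGroup : Grp → Grp
AutGroup T = Subgroup.group auts
  where
  open Group T using (setoid; _≈_; _∙_; ∙-cong; refl; sym; trans)
  open Inverse
  auts : Subgroup (Sym setoid)
  auts = record
    { member    = λ f → ∀ x y → to f (x ∙ y) ≈ to f x ∙ to f y
    ; ≈-closed  = λ p h x y → trans (sym (p _)) (trans (h x y) (∙-cong (p x) (p y)))
    ; ε-closed  = λ _ _ → refl
    ; ∙-closed  = λ {f} {g} hf hg x y → trans (to-cong f (hg x y)) (hf _ _)
    ; ⁻¹-closed = λ {f} h x y → inverseʳ f (sym (trans (h _ _)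
        (∙-cong (strictlyInverseˡ f x) (strictlyInverseˡ f y))))
    }

-- Inn T ≤ H ≤ Aut T for some non-abelian simple group T.
IsAlmostSimple : Grp → Set₁
IsAlmostSimple H = Σ[ T ∈ Grp ] (IsSimple T × IsNonabelian T × embeds T)
  where
  module H = Group H
  embeds : Grp → Set
  embeds T = Σ[ ι ∈ (H.Carrier → A.Carrier) ] (IsGroupMonomorphism H.rawGroup A.rawGroup ι ×
      (∀ t → ∃[ h ] (∀ x → Inverse.to (proj₁ (ι h)) x ≈ t ∙ x ∙ t ⁻¹)))
    where
    module A = Group (AutGroup T)
    open Group T

record Action (G : Grp) (X : Setoid 0ℓ 0ℓ) : Set where
  open Group G using (Carrier; _∙_; ε) renaming (_≈_ to _≈ᴳ_)
  open Setoid X using (_≈_) renaming (Carrier to |X|)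
  infixr 6 _·_
  field
    _·_      : Carrier → |X| → |X|
    ·-cong   : ∀ {g h x y} → g ≈ᴳ h → x ≈ y → g · x ≈ h · y
    ·-ε      : ∀ x → ε · x ≈ x
    ·-compat : ∀ g h x → (g ∙ h) · x ≈ g · (h · x)

module _ {G : Grp} {X : Setoid 0ℓ 0ℓ} (α : Action G X) where
  open Group G using (Carrier; _∙_; ε; _⁻¹; refl; sym; assoc; identityˡ; identityʳ; inverseˡ; inverseʳ)
  open Setoid X renaming (Carrier to |X|; _≈_ to _≈ˣ_; refl to reflˣ; sym to symˣ; trans to transˣ) using ()
  open Action α

  private
    act-inverse : ∀ g {x y} → g · x ≈ˣ y → g ⁻¹ · y ≈ˣ x
    act-inverse g {x} p = transˣ (·-cong refl (symˣ p))
      (transˣ (symˣ (·-compat (g ⁻¹) g x)) (transˣ (·-cong (inverseˡ g) reflˣ) (·-ε x)))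

    act-compose : ∀ g h {x y z} → h · x ≈ˣ y → g · y ≈ˣ z → (g ∙ h) · x ≈ˣ z
    act-compose g h p q = transˣ (·-compat g h _) (transˣ (·-cong refl p) q)

  -- The permutation group induced on X, i.e. G modulo the kernel of the action.
  inducedGroup : Grp
  inducedGroup = record
    { Carrier = Carrier
    ; _≈_     = λ g h → ∀ x → g · x ≈ˣ h · x
    ; _∙_     = _∙_
    ; ε       = ε
    ; _⁻¹     = _⁻¹
    ; isGroup = record
      { isMonoid = record
        { isSemigroup = record
          { isMagma = record
            { isEquivalence = record
              { refl  = λ _ → reflˣ
              ; sym   = λ p x → symˣ (p x)
              ; trans = λ p q x → transˣ (p x) (q x)
              }
            ; ∙-cong = λ {g} {h} {k} {l} p q x →
                act-compose g k (q x) (transˣ (p (l · x)) (symˣ (·-compat h l x)))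
            }
          ; assoc = λ g h k x → ·-cong (assoc g h k) reflˣ
          }
        ; identity = (λ g x → ·-cong (identityˡ g) reflˣ) , (λ g x → ·-cong (identityʳ g) reflˣ)
        }
      ; inverse = (λ g x → ·-cong (inverseˡ g) reflˣ) , (λ g x → ·-cong (inverseʳ g) reflˣ)
      ; ⁻¹-cong = λ {g} {h} p x → act-inverse g (transˣ (p (h ⁻¹ · x))
          (transˣ (symˣ (·-compat h (h ⁻¹) x)) (transˣ (·-cong (inverseʳ h) reflˣ) (·-ε x))))
      }
    }

  restrict : (H : Subgroup G) → Action (Subgroup.group H) X
  restrict H = record
    { _·_      = λ h x → proj₁ h · x
    ; ·-cong   = ·-cong
    ; ·-ε      = ·-ε
    ; ·-compat = λ g h → ·-compat (proj₁ g) (proj₁ h)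
    }

  stabiliser : |X| → Subgroup G
  stabiliser x = record
    { member    = λ g → g · x ≈ˣ x
    ; ≈-closed  = λ p q → transˣ (·-cong (sym p) reflˣ) q
    ; ε-closed  = ·-ε x
    ; ∙-closed  = λ {g} {h} p q → act-compose g h q p
    ; ⁻¹-closed = λ {g} p → act-inverse g p
    }

  orbits : Setoid 0ℓ 0ℓ
  orbits = record
    { Carrier = |X|
    ; _≈_     = λ x y → ∃[ g ] (g · x ≈ˣ y)
    ; isEquivalence = record
      { refl  = ε , ·-ε _
      ; sym   = λ (g , p) → g ⁻¹ , act-inverse g p
      ; trans = λ (g , p) (h , q) → h ∙ g , act-compose h g p q
      }
    }

  IsTransitive : Set
  IsTransitive = ∀ x y → ∃[ g ] (g · x ≈ˣ y)

  record SystemOfImprimitivity : Set₁ where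
    infix 4 _∼_
    field
      _∼_           : Rel |X| 0ℓ
      isEquivalence : IsEquivalence _∼_
      ≈⇒∼           : ∀ {x y} → x ≈ˣ y → x ∼ y
      invariant     : ∀ g {x y} → x ∼ y → g · x ∼ g · y

    open IsEquivalence isEquivalence renaming (trans to ∼-trans) using ()

    -- The set of parts: X with ∼ as equality.
    parts : Setoid 0ℓ 0ℓ
    parts = record { isEquivalence = isEquivalence }

    onParts : Action G parts
    onParts = record
      { _·_      = _·_
      ; ·-cong   = λ {g} {h} p q → ∼-trans (≈⇒∼ (·-cong p reflˣ)) (invariant h q)
      ; ·-ε      = λ x → ≈⇒∼ (·-ε x)
      ; ·-compat = λ g h x → ≈⇒∼ (·-compat g h x)
      }

    IsNontrivialSystem : Set
    IsNontrivialSystem = (∀ x → ∃[ y ] (x ∼ y × ¬ x ≈ˣ y)) × (∀ x → ∃[ y ] ¬ x ∼ y)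

HasRank : {G : Grp} {X : Setoid 0ℓ 0ℓ} → Action G X → ℕ → Set
HasRank {X = X} α n = IsTransitive α ×
  (∃[ x ] Inverse (orbits (restrict α (stabiliser α x))) (≡.setoid (Fin n)))

IsEquivariant : {G H : Grp} {X Y : Setoid 0ℓ 0ℓ} → (Group.Carrier G → Group.Carrier H) →
                Action G X → Action H Y → Inverse X Y → Set
IsEquivariant {Y = Y} φ α β f = ∀ g x → to f (g · x) ≈ φ g ·′ to f x
  where
  open Inverse
  open Setoid Y using (_≈_)
  open Action α using (_·_)
  open Action β using () renaming (_·_ to _·′_)

record Design : Set₁ where
  field
    v b : ℕ
    I   : REL (Fin v) (Fin b) 0ℓ
    I?  : Decidable I

  Point Block : Set
  Point = Fin v
  Block = Fin b

  Points Blocks : Setoid 0ℓ 0ℓ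
  Points = ≡.setoid Point
  Blocks = ≡.setoid Block

  Intersecting : Rel Block 0ℓ
  Intersecting B C = ∃[ p ] (I p B × I p C)

  record Is2Design (k ƛ : ℕ) : Set where
    field
      blockSize : ∀ B → count (λ p → I? p B) (allFin v) ≡ k
      balance   : ∀ p p′ → p ≢ p′ → count (λ B → I? p B ×-dec I? p′ B) (allFin b) ≡ ƛ

  -- A permutation of the disjoint union of points and blocks fixing both
  -- sets setwise is a pair of permutations.
  Aut : Grp
  Aut = Subgroup.group auts
    where
    open Inverse
    open Equivalence using () renaming (to to fwd; from to bwd)
    auts : Subgroup (DirectProduct.group (Sym Points) (Sym Blocks))
    auts = record
      { member    = λ (π , ρ) → ∀ p B → I p B ⇔ I (to π p) (to ρ B)
      ; ≈-closed  = λ (e , e′) h p B → ≡.subst₂ (λ x y → I p B ⇔ I x y) (e p) (e′ B) (h p B)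
      ; ε-closed  = λ _ _ → mk⇔ (λ x → x) (λ x → x)
      ; ∙-closed  = λ {(π , ρ)} {(π′ , ρ′)} h h′ p B →
          mk⇔ (fwd (h _ _) ∘ fwd (h′ p B)) (bwd (h′ p B) ∘ bwd (h _ _))
      ; ⁻¹-closed = λ {(π , ρ)} h p B → mk⇔
          (bwd (h _ _) ∘ ≡.subst₂ I (≡.sym (strictlyInverseˡ π p)) (≡.sym (strictlyInverseˡ ρ B)))
          (≡.subst₂ I (strictlyInverseˡ π p) (strictlyInverseˡ ρ B) ∘ fwd (h _ _))
      }

module _ {D : Design} (G : Subgroup (Design.Aut D)) where
  open Design D
  open Inverse

  onPoints : Action (Subgroup.group G) Points
  onPoints = record
    { _·_      = λ (((π , ρ) , _) , _) → to π
    ; ·-cong   = λ { (e , _) ≡.refl → e _ }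
    ; ·-ε      = λ _ → ≡.refl
    ; ·-compat = λ _ _ _ → ≡.refl
    }

  onBlocks : Action (Subgroup.group G) Blocks
  onBlocks = record
    { _·_      = λ (((π , ρ) , _) , _) → to ρ
    ; ·-cong   = λ { (_ , e) ≡.refl → e _ }
    ; ·-ε      = λ _ → ≡.refl
    ; ·-compat = λ _ _ _ → ≡.refl
    }

  TransitiveOnPairs : {X Y : Setoid 0ℓ 0ℓ} → Action (Subgroup.group G) X → Action (Subgroup.group G) Y →
                      REL (Setoid.Carrier X) (Setoid.Carrier Y) 0ℓ → Set
  TransitiveOnPairs {X} {Y} α β R = ∀ {x y x′ y′} → R x y → R x′ y′ →
      ∃[ g ] (Setoid._≈_ X (Action._·_ α g x) x′ × Setoid._≈_ Y (Action._·_ β g y) y′)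

  record IsPairwiseTransitive : Set where
    field
      points                : TransitiveOnPairs onPoints onPoints (λ p p′ → p ≢ p′)
      flags                 : TransitiveOnPairs onPoints onBlocks I
      antiflags             : TransitiveOnPairs onPoints onBlocks (λ p B → ¬ I p B)
      intersectingBlocks    : TransitiveOnPairs onBlocks onBlocks (λ B C → B ≢ C × Intersecting B C)
      nonintersectingBlocks : TransitiveOnPairs onBlocks onBlocks (λ B C → ¬ Intersecting B C)

IsPrimePower : ℕ → Set
IsPrimePower q = ∃[ p ] ∃[ n ] (Prime p × NonZero n × q ≡ p ^ n)

-- The apartness of a Heyting field is classically just ≉.
record FiniteField (q : ℕ) : Set₁ where
  field
    heytingField : HeytingField 0ℓ 0ℓ 0ℓ
  open HeytingField heytingField using (heytingCommutativeRing)
  open HeytingCommutativeRing heytingCommutativeRing using (commutativeRing)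
  field
    enumeration : Inverse (CommutativeRing.setoid commutativeRing) (≡.setoid (Fin q))

module ProjectiveSpace (F : HeytingField 0ℓ 0ℓ 0ℓ) (a : ℕ) where
  open HeytingField F using (heytingCommutativeRing)
  open HeytingCommutativeRing heytingCommutativeRing using (commutativeRing)
  open CommutativeRing commutativeRing
    using (_≈_; _+_; _*_; -_; 0#; 1#; setoid; semiring; rawRing; refl; sym; trans; +-cong; *-cong;
           +-identityˡ; *-identityˡ; *-assoc; *-comm; zeroˡ; -‿inverseʳ; +-group)
    renaming (Carrier to K)
  open SemiringSum semiring using (sum; sum-cong-≋)
  open RawSemiringDefinitions (Semiring.rawSemiring semiring) using () renaming (_^_ to _^ᴷ_)
  open Inverse

  V : Set
  V = Vector K a

  open Pointwise setoid using (_≋_; ≋-setoid)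

  Vₛ : Setoid 0ℓ 0ℓ
  Vₛ = ≋-setoid a

  0ᵛ : V
  0ᵛ _ = 0#

  infixl 6 _+ᵛ_
  infixr 7 _*ᵛ_

  _+ᵛ_ : V → V → V
  (x +ᵛ y) i = x i + y i

  _*ᵛ_ : K → V → V
  (c *ᵛ x) i = c * x i

  linearCombination : ∀ {d} → Vector K d → Vector V d → V
  linearCombination c u i = sum (λ j → c j * u j i)

  Span : ∀ {d} → Vector V d → Pred V 0ℓ
  Span u x = ∃[ c ] linearCombination c u ≋ x

  IsIndependent : ∀ {d} → Vector V d → Set
  IsIndependent u = ∀ c → linearCombination c u ≋ 0ᵛ → ∀ j → c j ≈ 0#

  -- A d-dimensional subspace is given by an independent family of d vectors;
  -- two such families are equal as subspaces when they span the same set.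
  record Basis (d : ℕ) : Set where
    field
      vectors     : Vector V d
      independent : IsIndependent vectors

  open Basis

  Subspaces : ℕ → Setoid 0ℓ 0ℓ
  Subspaces d = record
    { Carrier = Basis d
    ; _≈_     = λ U W → Span (vectors U) ≐ Span (vectors W)
    ; isEquivalence = record
      { refl  = (λ p → p) , (λ p → p)
      ; sym   = λ (p , q) → q , p
      ; trans = λ (p , q) (p′ , q′) → (λ z → p′ (p z)) , (λ z → q (q′ z))
      }
    }

  PGPoints PGHyperplanes : Setoid 0ℓ 0ℓ
  PGPoints      = Subspaces 1
  PGHyperplanes = Subspaces (a ∸ 1)

  AutField : Grp
  AutField = Subgroup.group auts
    where
    auts : Subgroup (Sym setoid)
    auts = record
      { member    = λ θ → IsRingHomomorphism rawRing rawRing (to θ)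
      ; ≈-closed  = λ {θ} {η} → closed≈ θ η
      ; ε-closed  = mkHom (λ p → p) (λ _ _ → refl) (λ _ _ → refl) refl
      ; ∙-closed  = λ {θ} {η} hθ hη →
          let module θ = IsRingHomomorphism hθ
              module η = IsRingHomomorphism hη
          in mkHom (λ p → to-cong θ (to-cong η p))
                   (λ x y → trans (to-cong θ (η.+-homo x y)) (θ.+-homo _ _))
                   (λ x y → trans (to-cong θ (η.*-homo x y)) (θ.*-homo _ _))
                   (trans (to-cong θ η.1#-homo) θ.1#-homo)
      ; ⁻¹-closed = λ {θ} hθ →
          let module θ = IsRingHomomorphism hθ
          in mkHom (from-cong θ)
                   (λ x y → inverseʳ θ (sym (trans (θ.+-homo _ _)
                      (+-cong (strictlyInverseˡ θ x) (strictlyInverseˡ θ y)))))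
                   (λ x y → inverseʳ θ (sym (trans (θ.*-homo _ _)
                      (*-cong (strictlyInverseˡ θ x) (strictlyInverseˡ θ y)))))
                   (inverseʳ θ (sym θ.1#-homo))
      }
      where
      mkHom : ∀ {f} → (∀ {x y} → x ≈ y → f x ≈ f y) →
              (∀ x y → f (x + y) ≈ f x + f y) → (∀ x y → f (x * y) ≈ f x * f y) →
              f 1# ≈ 1# → IsRingHomomorphism rawRing rawRing f
      mkHom {f} cong plus times one = record
        { isSemiringHomomorphism = record
          { isNearSemiringHomomorphism = record
            { +-isMonoidHomomorphism = record
              { isMagmaHomomorphism = record { isRelHomomorphism = record { cong = cong } ; homo = plus }
              ; ε-homo = zero-homo
              }
            ; *-homo = times
            }
          ; 1#-homo = one
          }
        ; -‿homo = λ x → inverseʳ-unique _ _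
            (trans (sym (plus x (- x))) (trans (cong (-‿inverseʳ x)) zero-homo))
        }
        where
        open GroupProperties +-group using (inverseʳ-unique; identityˡ-unique)
        zero-homo : f 0# ≈ 0#
        zero-homo = identityˡ-unique _ _ (trans (sym (plus 0# 0#)) (cong (+-identityˡ 0#)))

      closed≈ : ∀ θ η → (∀ x → to θ x ≈ to η x) →
                IsRingHomomorphism rawRing rawRing (to θ) → IsRingHomomorphism rawRing rawRing (to η)
      closed≈ θ η p hθ = mkHom (to-cong η)
        (λ x y → trans (sym (p _)) (trans (θ.+-homo x y) (+-cong (p x) (p y))))
        (λ x y → trans (sym (p _)) (trans (θ.*-homo x y) (*-cong (p x) (p y))))
        (trans (sym (p 1#)) θ.1#-homo)
        where module θ = IsRingHomomorphism hθ

  private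
    module AutField = Group AutField

  _⟨_⟩ : AutField.Carrier → K → K
  θ ⟨ c ⟩ = to (proj₁ θ) c

  record IsSemilinear (θ : AutField.Carrier) (f : V → V) : Set where
    field
      +ᵛ-homo : ∀ x y → f (x +ᵛ y) ≋ f x +ᵛ f y
      *ᵛ-homo : ∀ c x → f (c *ᵛ x) ≋ (θ ⟨ c ⟩) *ᵛ f x

  open IsSemilinear

  ΓL : Grp
  ΓL = Subgroup.group semilinear
    where
    semilinear : Subgroup (Sym Vₛ)
    semilinear = record
      { member    = λ f → ∃[ θ ] IsSemilinear θ (to f)
      ; ≈-closed  = λ p (θ , h) → θ , record
          { +ᵛ-homo = λ x y i → trans (sym (p _ i)) (trans (+ᵛ-homo h x y i) (+-cong (p x i) (p y i)))
          ; *ᵛ-homo = λ c x i → trans (sym (p _ i)) (trans (*ᵛ-homo h c x i) (*-cong refl (p x i)))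
          }
      ; ε-closed  = AutField.ε , record { +ᵛ-homo = λ _ _ _ → refl ; *ᵛ-homo = λ _ _ _ → refl }
      ; ∙-closed  = λ {f} {g} (θ , hf) (η , hg) → θ AutField.∙ η , record
          { +ᵛ-homo = λ x y i → trans (to-cong f (+ᵛ-homo hg x y) i) (+ᵛ-homo hf _ _ i)
          ; *ᵛ-homo = λ c x i → trans (to-cong f (*ᵛ-homo hg c x) i) (*ᵛ-homo hf _ _ i)
          }
      ; ⁻¹-closed = λ {f} (θ , hf) → θ AutField.⁻¹ , record
          { +ᵛ-homo = λ x y → inverseʳ f (λ i → sym (trans (+ᵛ-homo hf _ _ i)
              (+-cong (strictlyInverseˡ f x i) (strictlyInverseˡ f y i))))
          ; *ᵛ-homo = λ c x → inverseʳ f (λ i → sym (trans (*ᵛ-homo hf _ _ i)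
              (*-cong (strictlyInverseˡ (proj₁ θ) c) (strictlyInverseˡ f x i))))
          }
      }

  private
    module ΓL = Group ΓL

  ⟦_⟧ : ΓL.Carrier → V → V
  ⟦ f ⟧ = to (proj₁ f)

  Scalars : Subgroup ΓL
  Scalars = record
    { member    = λ f → ∃[ c ] ∃[ d ] (c * d ≈ 1# × ∀ x → ⟦ f ⟧ x ≋ c *ᵛ x)
    ; ≈-closed  = λ p (c , d , e , h) → c , d , e , λ x i → trans (sym (p x i)) (h x i)
    ; ε-closed  = 1# , 1# , *-identityˡ 1# , λ x i → sym (*-identityˡ (x i))
    ; ∙-closed  = λ {f} {g} (c , d , e , h) (c′ , d′ , e′ , h′) → c * c′ , d′ * d , units e e′ ,
        λ x i → trans (h _ i) (trans (*-cong refl (h′ x i)) (sym (*-assoc c c′ (x i))))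
    ; ⁻¹-closed = λ {f} (c , d , e , h) → d , c , trans (*-comm d c) e ,
        λ x → inverseʳ (proj₁ f) (λ i → sym (trans (h (d *ᵛ x) i) (cancel e (x i))))
    }
    where
    cancel : ∀ {c d} → c * d ≈ 1# → ∀ z → c * (d * z) ≈ z
    cancel e z = trans (sym (*-assoc _ _ z)) (trans (*-cong e refl) (*-identityˡ z))
    units : ∀ {c d c′ d′} → c * d ≈ 1# → c′ * d′ ≈ 1# → (c * c′) * (d′ * d) ≈ 1#
    units {c} {d} {c′} {d′} e e′ = trans (*-assoc c c′ (d′ * d)) (trans (*-cong refl (cancel e′ d)) e)

  Scalars-normal : IsNormal Scalars
  Scalars-normal g@(_ , θ , hg) {f} (c , d , e , h) =
    θ ⟨ c ⟩ , θ ⟨ d ⟩ , trans (sym (θ.*-homo c d)) (trans (to-cong (proj₁ θ) e) θ.1#-homo) ,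
    λ x i → trans (to-cong (proj₁ g) (h _) i)
      (trans (*ᵛ-homo hg c _ i) (*-cong refl (strictlyInverseˡ (proj₁ g) x i)))
    where module θ = IsRingHomomorphism (proj₂ θ)

  PΓL : Grp
  PΓL = quotient ΓL Scalars Scalars-normal

  -- Laplace expansion along the first row.
  det : ∀ {n} → (Fin n → Fin n → K) → K
  det {zero}  M = 1#
  det {suc n} M = sum (λ j → ((- 1#) ^ᴷ toℕ j) * (M zero j * det (λ i k → M (suc i) (punchIn j k))))

  unitVector : Fin a → V
  unitVector j i with i Fin.≟ j
  ... | yes _ = 1#
  ... | no  _ = 0#

  matrix : (V → V) → Fin a → Fin a → K
  matrix f i j = f (unitVector j) i

  SL : Pred ΓL.Carrier 0ℓ
  SL f = IsSemilinear AutField.ε ⟦ f ⟧ × det (matrix ⟦ f ⟧) ≈ 1#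

  -- The image of SL(a,F) in PΓL(a,F).
  PSL : Pred (Group.Carrier PΓL) 0ℓ
  PSL x = ∃[ f ] (f ∈ SL × Group._≈_ PΓL f x)

  lincomb-cong : ∀ {d} {c c′ : Vector K d} {u u′ : Vector V d} → (∀ j → c j ≈ c′ j) → (∀ j → u j ≋ u′ j) →
                 linearCombination c u ≋ linearCombination c′ u′
  lincomb-cong p q i = sum-cong-≋ (λ j → *-cong (p j) (q j i))

  image : ∀ {d} (f : ΓL.Carrier) (c : Vector K d) (u : Vector V d) →
          ⟦ f ⟧ (linearCombination c u) ≋
          linearCombination (λ j → proj₁ (proj₂ f) ⟨ c j ⟩) (λ j → ⟦ f ⟧ (u j))
  image {zero} f@(_ , θ , hf) c u i = trans (to-cong (proj₁ f) (λ k → sym (zeroˡ _)) i)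
    (trans (*ᵛ-homo hf 0# 0ᵛ i) (trans (*-cong θ.0#-homo refl) (zeroˡ _)))
    where module θ = IsRingHomomorphism (proj₂ θ)
  image {suc d} f@(_ , θ , hf) c u i =
    trans (+ᵛ-homo hf (c zero *ᵛ u zero) (linearCombination (c ∘ suc) (u ∘ suc)) i)
      (+-cong (*ᵛ-homo hf (c zero) (u zero) i) (image f (c ∘ suc) (u ∘ suc) i))

  span-image : ∀ {d} (f : ΓL.Carrier) {u : Vector V d} {x} → x ∈ Span (λ j → ⟦ f ⟧ (u j)) →
               from (proj₁ f) x ∈ Span u
  span-image f@(_ , θ , _) {u} {x} (c , p) = (λ j → from (proj₁ θ) (c j)) ,
    λ i → sym (inverseʳ (proj₁ f) (λ k → trans (sym (p k)) (sym (trans (image f _ u k)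
      (lincomb-cong {u = λ j → ⟦ f ⟧ (u j)} (λ j → strictlyInverseˡ (proj₁ θ) (c j)) (λ _ _ → refl) k)))) i)

  image-span : ∀ {d} (f : ΓL.Carrier) {u : Vector V d} {x} → from (proj₁ f) x ∈ Span u →
               x ∈ Span (λ j → ⟦ f ⟧ (u j))
  image-span f {u} {x} (c , p) = _ ,
    λ i → trans (sym (image f c u i)) (trans (to-cong (proj₁ f) p i) (strictlyInverseˡ (proj₁ f) x i))

  apply : ∀ {d} → ΓL.Carrier → Basis d → Basis d
  apply f@(_ , θ , hf) U = record
    { vectors     = λ j → ⟦ f ⟧ (vectors U j)
    ; independent = λ c p j →
        trans (sym (strictlyInverseˡ (proj₁ θ) (c j)))
          (trans (to-cong (proj₁ θ) (independent U _ (preimage c p) j)) θ.0#-homo)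
    }
    where
    module θ = IsRingHomomorphism (proj₂ θ)
    preimage : ∀ c → linearCombination c (λ j → ⟦ f ⟧ (vectors U j)) ≋ 0ᵛ →
               linearCombination (λ j → from (proj₁ θ) (c j)) (vectors U) ≋ 0ᵛ
    preimage c p i = trans (proj₂ (span-image f {vectors U} {0ᵛ} (c , p)) i)
      (inverseʳ (proj₁ f) {0ᵛ} {0ᵛ} (λ k → sym
        (trans (to-cong (proj₁ f) {0ᵛ} {0# *ᵛ 0ᵛ} (λ _ → sym (zeroˡ _)) k)
          (trans (*ᵛ-homo hf 0# 0ᵛ k) (trans (*-cong θ.0#-homo refl) (zeroˡ _))))) i)

  -- Elements of ΓL that agree modulo scalars send u to families with the same span.
  span-scalar : ∀ {d} (f g : ΓL.Carrier) → Group._≈_ PΓL f g → (u : Vector V d) →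
                Span (λ j → ⟦ f ⟧ (u j)) ⊆ Span (λ j → ⟦ g ⟧ (u j))
  span-scalar f g (c , d , e , h) u (k , p) = (λ j → k j * c) ,
    λ i → trans (sum-cong-≋ (λ j → trans (*-assoc (k j) c _) (*-cong refl (sym (scaled j i))))) (p i)
    where
    scaled : ∀ j → ⟦ f ⟧ (u j) ≋ c *ᵛ ⟦ g ⟧ (u j)
    scaled j i = trans (to-cong (proj₁ f) (λ k → sym (strictlyInverseʳ (proj₁ g) (u j) k)) i) (h (⟦ g ⟧ (u j)) i)

  onSubspaces : ∀ d → Action PΓL (Subspaces d)
  onSubspaces d = record
    { _·_      = apply
    ; ·-cong   = λ {f} {g} {U} {W} p (q , q′) →
        (λ z → span-scalar f g p (vectors W) (image-span f (q (span-image f z)))) ,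
        (λ z → image-span f (q′ (span-image f (span-scalar g f (Group.sym PΓL {f} {g} p) (vectors W) z))))
    ; ·-ε      = λ _ → (λ z → z) , (λ z → z)
    ; ·-compat = λ _ _ _ → (λ z → z) , (λ z → z)
    }

  onPGPoints : Action PΓL PGPoints
  onPGPoints = onSubspaces 1

  onPGHyperplanes : Action PΓL PGHyperplanes
  onPGHyperplanes = onSubspaces (a ∸ 1)

-- G has socle PSL(a,F), and acts on the points of D and on S as on the points
-- and hyperplanes of the projective space. Both actions are transported along
-- one and the same φ, which identifies Soc(G) with PSL(a,F); with independent
-- identifications, points and hyperplanes could be exchanged by a duality.
record ArePointHyperplaneActions {D : Design} (G : Subgroup (Design.Aut D))
                                 (S : SystemOfImprimitivity (onBlocks {D} G))
                                 (a : ℕ) (F : HeytingField 0ℓ 0ℓ 0ℓ) : Set₁ where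
  open ProjectiveSpace F a
  open Group (Subgroup.group G) using (Carrier; _≈_; rawGroup)
  open Group PΓL using () renaming (Carrier to Carrier′; _≈_ to _≈′_; rawGroup to rawGroup′)
  field
    φ                : Carrier → Carrier′
    φ-homomorphism   : IsGroupHomomorphism rawGroup rawGroup′ φ
    socle-injective  : ∀ {g h} → g ∈ Socle (Subgroup.group G) → h ∈ Socle (Subgroup.group G) →
                       φ g ≈′ φ h → g ≈ h
    socle⊆PSL        : ∀ {g} → g ∈ Socle (Subgroup.group G) → φ g ∈ PSL
    PSL⊆socle        : ∀ {x} → x ∈ PSL → ∃[ g ] (g ∈ Socle (Subgroup.group G) × φ g ≈′ x)
    pointMap         : Inverse (Design.Points D) PGPoints
    pointMap-equiv   : IsEquivariant φ (onPoints {D} G) onPGPoints pointMap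
    partMap          : Inverse (SystemOfImprimitivity.parts S) PGHyperplanes
    partMap-equiv    : IsEquivariant φ (SystemOfImprimitivity.onParts S) onPGHyperplanes partMap

{-# OPTIONS --safe #-}

-- The point set of a block B is an orbit of the stabiliser G_B, and so is its
-- complement. As G_B also stabilises the hyperplane H corresponding to the part
-- containing B, the block B is H or the complement of H, and by flag-transitivity
-- the same alternative holds for all blocks. For a ≥ 3 any two hyperplanes meet
-- and do not cover the space, so in either case any two blocks intersect. Hence
-- G is transitive on ordered pairs of distinct blocks, and every G-invariant
-- partition of the blocks is trivial.

module Submission where

open import Defs
open import Algebra.Apartness.Bundles using (HeytingField; HeytingCommutativeRing)
import Algebra.Apartness.Properties.HeytingCommutativeRing as HeytingProperties
open import Algebra.Bundles using (CommutativeRing)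
import Algebra.Properties.Ring as RingProperties
import Algebra.Properties.Semiring.Sum as SemiringSum
open import Data.Fin.Base using (Fin; zero; suc; combine; finToFun; funToFin; splitAt; join; _↑ˡ_; _↑ʳ_)
import Data.Fin.Properties as Fin
open import Data.Nat.Base using (ℕ; zero; suc; _+_; _∸_; _^_; _<_; _≤_; z<s; s<s; s≤s)
import Data.Nat.Properties as ℕ
open import Data.Product.Base using (Σ-syntax; map; ∃₂; ∃-syntax; _×_; _,_; proj₁; proj₂)
open import Data.Sum.Base using (_⊎_; inj₁; inj₂; [_,_])
open import Data.Vec.Functional using (Vector)
import Data.Vec.Functional.Relation.Binary.Equality.Setoid as Pointwise
open import Function.Base using (id; _∘_)
open import Function.Bundles using (Injection; Inverse)
open import Function.Properties.Inverse using (Inverse⇒Injection)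
open import Level using (0ℓ)
open import Relation.Binary.Bundles using (Setoid)
open import Relation.Binary.Core using (REL)
open import Relation.Binary.Definitions using (Decidable)
open import Relation.Binary.PropositionalEquality as ≡ using (_≡_; _≢_; _≗_)
import Relation.Binary.Reasoning.Setoid as SetoidReasoning
open import Relation.Nullary.Decidable using (Dec; yes; no; map′; via-injection; decidable-stable)
open import Relation.Nullary.Negation using (¬_; contradiction)
open import Relation.Unary using (_∈_; _∉_; _⊆_)

-- Finite functions and the arithmetic of hyperplane dimensions.

funToFin-cong : ∀ {m n} {f g : Fin m → Fin n} → f ≗ g → funToFin f ≡ funToFin g
funToFin-cong {zero}  f≗g = ≡.refl
funToFin-cong {suc m} f≗g = ≡.cong₂ combine (f≗g zero) (funToFin-cong (f≗g ∘ suc))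

distinct⇒1<n : ∀ {n} {i j : Fin n} → i ≢ j → 1 < n
distinct⇒1<n {suc zero}    {zero} {zero} i≢j = contradiction ≡.refl i≢j
distinct⇒1<n {suc (suc n)} _                 = s<s z<s

0<a⇒a∸1<a : ∀ {a} → 0 < a → a ∸ 1 < a
0<a⇒a∸1<a (s≤s _) = ℕ.≤-refl

3≤a⇒a<[a∸1]+[a∸1] : ∀ {a} → 3 ≤ a → a < (a ∸ 1) + (a ∸ 1)
-- Here `a` is the predecessor, and the goal unfolds to `2 + a ≤ a + a`.
3≤a⇒a<[a∸1]+[a∸1] {suc a} (s≤s 2≤a) = ℕ.+-monoˡ-≤ a 2≤a

-- Linear algebra over a finite field, by counting vectors.

module LinearAlgebra {q : ℕ} (F : FiniteField q) (a : ℕ) where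
  open FiniteField F
  open HeytingField heytingField using (heytingCommutativeRing; _#_; #⇒invertible; tight)
  open HeytingProperties heytingCommutativeRing using (1#0; x-0≈x)
  open HeytingCommutativeRing heytingCommutativeRing using (commutativeRing)
  open CommutativeRing commutativeRing
    using (_≈_; _*_; -_; _-_; 0#; 1#; setoid; semiring; ring; refl; sym; trans; +-cong; +-congˡ; +-congʳ; *-congˡ; *-congʳ;
           +-identityˡ; +-identityʳ; +-assoc; +-comm; *-assoc; *-identityˡ; zeroˡ; zeroʳ; distribʳ; -‿inverseʳ; -‿inverseˡ; -‿cong)
    renaming (Carrier to K; _+_ to _⊕_)
  open RingProperties ring using (-1*x≈-x; x∙y⁻¹≈ε⇒x≈y)
  open SemiringSum semiring using (sum-cong-≋; sum-replicate-zero; ∑-distrib-+; *-distribˡ-sum)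
  open ProjectiveSpace heytingField a
  open Pointwise setoid using (_≋_; ≋-setoid)
  open Inverse
  open SetoidReasoning setoid

  -- Since `1#` is apart from `0#`, their indices differ. This makes `q ^ n` strictly increasing in
  -- `n`, which the counting arguments need.
  1<q : 1 < q
  1<q = distinct⇒1<n {i = to enumeration 1#} {to enumeration 0#}
    (λ e → proj₂ (tight 1# 0#) (Injection.injective (Inverse⇒Injection enumeration) e) 1#0)

  vectorEnumeration : ∀ n → Inverse (≋-setoid n) (≡.setoid (Fin (q ^ n)))
  vectorEnumeration n = record
    { to        = λ x → funToFin (to enumeration ∘ x)
    ; from      = λ k i → from enumeration (finToFun k i)
    ; to-cong   = λ x≋y → funToFin-cong (λ i → to-cong enumeration (x≋y i))
    ; from-cong = λ { ≡.refl _ → refl }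
    ; inverse   =
        (λ {k} x≋k → ≡.trans
          (funToFin-cong (λ i → inverseˡ enumeration (x≋k i)))
          (Fin.funToFin-finToFin {n} k)) ,
        (λ { {x} ≡.refl i → inverseʳ enumeration (Fin.finToFun-funToFin (to enumeration ∘ x) i) })
    }

  _≋?_ : ∀ {n} → Decidable (_≋_ {n})
  _≋?_ {n} = via-injection (Inverse⇒Injection (vectorEnumeration n)) Fin._≟_

  -- Takes the place of dimension theory: `q ^ m < q ^ n`. The map `f` need not respect `≋`, since
  -- it is only evaluated at enumerated vectors.
  vector-pigeonhole : ∀ {m n} → m < n → (f : Vector K n → Vector K m) →
                      ∃₂ λ x y → ¬ x ≋ y × f x ≋ f y
  vector-pigeonhole {m} {n} m<n f
    with i , j , i<j , e ← Fin.pigeonhole (ℕ.^-monoʳ-< q 1<q m<n)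
                             (to (vectorEnumeration m) ∘ f ∘ from (vectorEnumeration n))
    = from (vectorEnumeration n) i , from (vectorEnumeration n) j ,
      (λ p → Fin.<⇒≢ i<j (≡.trans (≡.sym (strictlyInverseˡ (vectorEnumeration n) i))
        (inverseˡ (vectorEnumeration n) p))) ,
      Injection.injective (Inverse⇒Injection (vectorEnumeration m)) e

  -- Serves for differences of combinations, with `k` equal to `- 1#`, and for multiples of one
  -- combination, with `c` zero.
  combination-linear : ∀ {d} (c c′ : Vector K d) k (u : Vector V d) →
    linearCombination (λ j → c j ⊕ k * c′ j) u ≋ linearCombination c u +ᵛ k *ᵛ linearCombination c′ u
  combination-linear c c′ k u i = begin
    linearCombination (λ j → c j ⊕ k * c′ j) u i
      ≈⟨ sum-cong-≋ (λ j → trans (distribʳ (u j i) (c j) (k * c′ j)) (+-congˡ (*-assoc k (c′ j) (u j i)))) ⟩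
    _ ≈⟨ ∑-distrib-+ (λ j → c j * u j i) (λ j → k * (c′ j * u j i)) ⟩
    _ ≈⟨ +-congˡ (*-distribˡ-sum k (λ j → c′ j * u j i)) ⟨
    (linearCombination c u +ᵛ k *ᵛ linearCombination c′ u) i ∎

  combination-zero : ∀ {d} (u : Vector V d) → linearCombination (λ _ → 0#) u ≋ 0ᵛ
  combination-zero {d} u i = trans (sum-cong-≋ (λ j → zeroˡ (u j i))) (sum-replicate-zero d)

  combination-difference : ∀ {d} (c c′ : Vector K d) (u : Vector V d) → ∀ i →
    linearCombination (λ j → c j ⊕ (- 1#) * c′ j) u i ≈ linearCombination c u i - linearCombination c′ u i
  combination-difference c c′ u i = trans (combination-linear c c′ (- 1#) u i) (+-congˡ (-1*x≈-x _))

  independent⇒coefficients-≋ : ∀ {d} {u : Vector V d} → IsIndependent u → ∀ {c c′} →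
    linearCombination (λ j → c j ⊕ (- 1#) * c′ j) u ≋ 0ᵛ → c ≋ c′
  independent⇒coefficients-≋ ind {c} {c′} p j =
    x∙y⁻¹≈ε⇒x≈y _ _ (trans (+-congˡ (sym (-1*x≈-x (c′ j)))) (ind _ p j))

  Span-≋ : ∀ {d} (u : Vector V d) {x y} → x ≋ y → x ∈ Span u → y ∈ Span u
  Span-≋ u x≋y (c , p) = c , λ i → trans (p i) (x≋y i)

  Span-difference : ∀ {d} (u : Vector V d) {x y} → x +ᵛ y ∈ Span u → y ∈ Span u → x ∈ Span u
  Span-difference u {x} {y} (c , p) (c′ , p′) = _ , λ i → begin
    _                 ≈⟨ combination-difference c c′ u i ⟩
    _                 ≈⟨ +-cong (p i) (-‿cong (p′ i)) ⟩
    (x i ⊕ y i) - y i ≈⟨ +-assoc (x i) (y i) (- y i) ⟩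
    x i ⊕ (y i - y i) ≈⟨ +-congˡ (-‿inverseʳ (y i)) ⟩
    x i ⊕ 0#          ≈⟨ +-identityʳ (x i) ⟩
    x i               ∎

  Span? : ∀ {d} (u : Vector V d) x → Dec (x ∈ Span u)
  Span? {d} u x = map′
    (λ (k , p) → from E k , p)
    (λ (c , p) → to E c , λ i → trans
      (lincomb-cong {u = u} (strictlyInverseʳ E c) (λ _ _ → refl) i) (p i))
    (Fin.any? (λ k → linearCombination (from E k) u ≋? x))
    where E = vectorEnumeration d

  -- If every vector were spanned, choosing coefficients would map `a`-tuples to `d`-tuples; two
  -- distinct vectors would then share coefficients and be equal.
  outside : ∀ {d} → d < a → (u : Vector V d) → ∃[ x ] x ∉ Span u
  outside d<a u = map (from E) id
    -- Finiteness and decidable membership turn the refutation into a witness.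
    (Fin.¬∀⟶∃¬ _ (λ k → from E k ∈ Span u) (λ k → Span? u (from E k)) notAll)
    where
    E = vectorEnumeration a
    notAll : ¬ (∀ k → from E k ∈ Span u)
    notAll all = x≉y (λ i → begin
      x i                               ≈⟨ proj₂ (spanned x) i ⟨
      linearCombination (coeffs x) u i  ≈⟨ lincomb-cong {u = u} fx≋fy (λ _ _ → refl) i ⟩
      linearCombination (coeffs y) u i  ≈⟨ proj₂ (spanned y) i ⟩
      y i                               ∎)
      where
      spanned : ∀ x → x ∈ Span u
      spanned x = Span-≋ u (strictlyInverseʳ E x) (all (to E x))
      coeffs : V → Vector K _
      coeffs x = proj₁ (spanned x)
      collision = vector-pigeonhole d<a coeffs
      x = proj₁ collision
      y = proj₁ (proj₂ collision)
      x≉y = proj₁ (proj₂ (proj₂ collision))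
      fx≋fy = proj₂ (proj₂ (proj₂ collision))

  -- A space is not the union of two proper subspaces: if `x` avoids only the first and `y` only the
  -- second, then `x +ᵛ y` avoids both.
  outside-both : ∀ {d} → d < a → (u w : Vector V d) → ∃[ x ] (x ∉ Span u × x ∉ Span w)
  outside-both d<a u w
    with x , x∉u ← outside d<a u | y , y∉w ← outside d<a w
    with Span? w x | Span? u y
  ... | no  x∉w | _       = x , x∉u , x∉w
  ... | yes x∈w | no  y∉u = y , y∉u , y∉w
  ... | yes x∈w | yes y∈u = x +ᵛ y ,
    (λ p → x∉u (Span-difference u p y∈u)) ,
    (λ p → y∉w (Span-difference w (Span-≋ w (λ i → +-comm (x i) (y i)) p) x∈w))

  ∉-Span⇒≉0 : ∀ {d} (u : Vector V d) {x} → x ∉ Span u → ¬ x ≋ 0ᵛ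
  ∉-Span⇒≉0 u x∉u x≋0 = x∉u ((λ _ → 0#) , λ i → trans (combination-zero u i) (sym (x≋0 i)))

  -- There are more pairs of coefficient vectors than vectors; two pairs with the
  -- same total differ by a relation between u and w.
  inside-both : ∀ {d e} → a < d + e → {u : Vector V d} {w : Vector V e} →
                IsIndependent u → IsIndependent w →
                ∃[ x ] (¬ x ≋ 0ᵛ × x ∈ Span u × x ∈ Span w)
  inside-both {d} {e} a<d+e {u} {w} u-ind w-ind
    with c , c′ , c≉c′ , same ← vector-pigeonhole a<d+e
           (λ c → linearCombination (c ∘ (_↑ˡ e)) u +ᵛ linearCombination (c ∘ (d ↑ʳ_)) w)
    = x , x≉0 , (_ , λ _ → refl) , (_ , λ i → sym (x≋w i))
    where
    left : Vector K (d + e) → Vector K d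
    left c = c ∘ (_↑ˡ e)
    right : Vector K (d + e) → Vector K e
    right c = c ∘ (d ↑ʳ_)
    x : V
    x = linearCombination (λ j → left c j ⊕ (- 1#) * left c′ j) u
    exchange : ∀ {s t s′ t′} → s ⊕ t ≈ s′ ⊕ t′ → s - s′ ≈ t′ - t
    exchange {s} {t} {s′} {t′} p = begin
      s - s′                   ≈⟨ +-congʳ (+-identityʳ s) ⟨
      (s ⊕ 0#) - s′            ≈⟨ +-congʳ (+-congˡ (-‿inverseʳ t)) ⟨
      (s ⊕ (t - t)) - s′       ≈⟨ +-congʳ (+-assoc s t (- t)) ⟨
      (s ⊕ t - t) - s′         ≈⟨ +-congʳ (+-congʳ p) ⟩
      (s′ ⊕ t′ - t) - s′       ≈⟨ +-comm _ (- s′) ⟩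
      - s′ ⊕ (s′ ⊕ t′ - t)     ≈⟨ +-congˡ (+-assoc s′ t′ (- t)) ⟩
      - s′ ⊕ (s′ ⊕ (t′ - t))   ≈⟨ +-assoc (- s′) s′ (t′ - t) ⟨
      (- s′ ⊕ s′) ⊕ (t′ - t)   ≈⟨ +-congʳ (-‿inverseˡ s′) ⟩
      0# ⊕ (t′ - t)            ≈⟨ +-identityˡ (t′ - t) ⟩
      t′ - t                   ∎
    x≋w : x ≋ linearCombination (λ j → right c′ j ⊕ (- 1#) * right c j) w
    x≋w i = trans (combination-difference (left c) (left c′) u i)
      (trans (exchange (same i)) (sym (combination-difference (right c′) (right c) w i)))
    x≉0 : ¬ x ≋ 0ᵛ
    -- If `x` vanishes, so does its expression in `w`; independence on each side then makes `c` and
    -- `c′` agree on both blocks of indices.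
    x≉0 x≋0 = c≉c′ λ i → ≡.subst (λ i → c i ≈ c′ i) (Fin.join-splitAt d e i) (agree (splitAt d i))
      where
      agree : ∀ s → c (join d e s) ≈ c′ (join d e s)
      agree (inj₁ j) = independent⇒coefficients-≋ u-ind x≋0 j
      agree (inj₂ j) = sym (independent⇒coefficients-≋ w-ind (λ i → trans (sym (x≋w i)) (x≋0 i)) j)

  line : ∀ x → ¬ x ≋ 0ᵛ → Basis 1
  line x x≉0 = record
    { vectors     = λ _ → x
    -- By tightness it suffices to refute apartness from `0#`: an invertible coefficient would force
    -- `x` to vanish.
    ; independent = λ { c p zero → proj₁ (tight (c zero) 0#) (λ c#0 → x≉0 (killed c p c#0)) }
    }
    where
    killed : ∀ c → linearCombination c (λ _ → x) ≋ 0ᵛ → c zero # 0# → x ≋ 0ᵛ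
    -- The inverse obtained is that of `c zero - 0#`, and the one-term sum in `p` ends in `0#`; both
    -- zeros are adjusted on the way.
    killed c p c#0 i with c⁻¹ , c⁻¹c≈1 , _ ← #⇒invertible c#0 = begin
      x i                           ≈⟨ *-identityˡ (x i) ⟨
      1# * x i                      ≈⟨ *-congʳ c⁻¹c≈1 ⟨
      (c⁻¹ * (c zero - 0#)) * x i   ≈⟨ *-assoc c⁻¹ _ (x i) ⟩
      c⁻¹ * ((c zero - 0#) * x i)   ≈⟨ *-congˡ (*-congʳ (x-0≈x (c zero))) ⟩
      c⁻¹ * (c zero * x i)          ≈⟨ *-congˡ (+-identityʳ (c zero * x i)) ⟨
      c⁻¹ * (c zero * x i ⊕ 0#)     ≈⟨ *-congˡ (p i) ⟩
      c⁻¹ * 0#                      ≈⟨ zeroʳ c⁻¹ ⟩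
      0#                            ∎

  ∈-line : ∀ x → x ∈ Span {1} (λ _ → x)
  ∈-line x = (λ _ → 1#) , λ i → trans (+-identityʳ (1# * x i)) (*-identityˡ (x i))

  line⊆ : ∀ {d} (u : Vector V d) {x} → x ∈ Span u → Span {1} (λ _ → x) ⊆ Span u
  line⊆ u {x} (c , p) {y} (k , q) = _ , λ i → begin
    _                      ≈⟨ combination-linear (λ _ → 0#) c (k zero) u i ⟩
    _                      ≈⟨ +-cong (combination-zero u i) (*-congˡ (p i)) ⟩
    0# ⊕ k zero * x i      ≈⟨ +-comm 0# (k zero * x i) ⟩
    k zero * x i ⊕ 0#      ≈⟨ q i ⟩
    y i                    ∎

-- Consequences of pairwise transitivity.

module _ {D : Design} (G : Subgroup (Design.Aut D)) (transitive : IsPairwiseTransitive {D} G) where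
  open Design D
  open IsPairwiseTransitive transitive
  open Action (onPoints {D} G) using () renaming (_·_ to _·ᵖ_)
  open Action (onBlocks {D} G) using () renaming (_·_ to _·ᵇ_)

  -- Flags form one orbit and antiflags another, so an invariant relation that is neither empty nor
  -- full is incidence or its complement. One inclusion in each case is enough to produce incident
  -- points.
  invariant⇒incidence-or-complement :
    (J : REL Point Block 0ℓ) → (∀ g {p B} → J p B → J (g ·ᵖ p) (g ·ᵇ B)) →
    ∃₂ J → (∃₂ λ p B → ¬ J p B) →
    (∀ {p B} → J p B → I p B) ⊎ (∀ {p B} → ¬ J p B → I p B)
  invariant⇒incidence-or-complement J invariant (p , B , j) (p′ , B′ , ¬j′) = cases (I? p B)
    where
    move : ∀ {p₁ B₁ p₂ B₂} → (∃[ g ] (g ·ᵖ p₁ ≡ p₂ × g ·ᵇ B₁ ≡ B₂)) → J p₁ B₁ → J p₂ B₂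
    move (g , ≡.refl , ≡.refl) = invariant g
    cases : Dec (I p B) → (∀ {p B} → J p B → I p B) ⊎ (∀ {p B} → ¬ J p B → I p B)
    -- All flags lie in `J`, so the pair outside `J` is an antiflag; an antiflag inside `J` would be
    -- carried to it.
    cases (yes i) = inj₁ λ {p₁} {B₁} j₁ → decidable-stable (I? p₁ B₁) λ ¬i₁ →
      ¬j′ (move (antiflags ¬i₁ (λ i′ → ¬j′ (move (flags i i′) j))) j₁)
    cases (no ¬i) = inj₂ λ {p₁} {B₁} ¬j₁ → decidable-stable (I? p₁ B₁) λ ¬i₁ →
      ¬j₁ (move (antiflags ¬i ¬i₁) j)

  pairwise-intersecting⇒systems-trivial :
    (∀ B C → Intersecting B C) → Block → (S : SystemOfImprimitivity (onBlocks {D} G)) →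
    ¬ SystemOfImprimitivity.IsNontrivialSystem S
  pairwise-intersecting⇒systems-trivial meet B S (related , unrelated) =
    let open SystemOfImprimitivity S
        (C , B∼C , B≢C)    = related B
        (C′ , B≁C′)        = unrelated B
        -- An element fixing `B` and taking `C` to `C′` would carry a related pair to an unrelated
        -- one.
        (g , gB≡B , gC≡C′) = intersectingBlocks (B≢C , meet B C) ((λ B≡C′ → B≁C′ (≈⇒∼ B≡C′)) , meet B C′)
    in B≁C′ (≡.subst₂ _∼_ gB≡B gC≡C′ (invariant g B∼C))

-- Blocks and the hyperplanes of their parts.

module _ {D : Design} {G : Subgroup (Design.Aut D)} {S : SystemOfImprimitivity (onBlocks {D} G)}
         {q a : ℕ} (3≤a : 3 ≤ a) (F : FiniteField q)
         (actions : ArePointHyperplaneActions {D} G S a (FiniteField.heytingField F)) where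
  open Design D
  open ProjectiveSpace (FiniteField.heytingField F) a
  open LinearAlgebra F a
  open ArePointHyperplaneActions actions
  open Basis
  open Inverse
  open Action (onPoints {D} G) using () renaming (_·_ to _·ᵖ_)
  open Action (onBlocks {D} G) using () renaming (_·_ to _·ᵇ_)

  -- The setoid of parts has the blocks as carrier, so `partMap` applies to a block and gives the
  -- hyperplane of its part.
  hyperplane : Block → Vector V (a ∸ 1)
  hyperplane B = vectors (to partMap B)

  LiesOn : REL Point Block 0ℓ
  LiesOn p B = Span (vectors (to pointMap p)) ⊆ Span (hyperplane B)

  -- Points and parts are moved by the same semilinear map `φ g`: pull a vector back along it, use
  -- the inclusion, and push forward again.
  LiesOn-invariant : ∀ g {p B} → LiesOn p B → LiesOn (g ·ᵖ p) (g ·ᵇ B)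
  LiesOn-invariant g {p} {B} p⊆B x∈gp =
    proj₂ (partMap-equiv g B) (image-span (φ g) {hyperplane B}
      (p⊆B (span-image (φ g) {vectors (to pointMap p)} (proj₁ (pointMap-equiv g p) x∈gp))))

  point : ∀ x → ¬ (Setoid._≈_ Vₛ x 0ᵛ) → Point
  point x x≉0 = from pointMap (line x x≉0)

  ∈⇒LiesOn : ∀ {x} x≉0 {B} → x ∈ Span (hyperplane B) → LiesOn (point x x≉0) B
  ∈⇒LiesOn {x} x≉0 {B} x∈B =
    line⊆ (hyperplane B) x∈B ∘ proj₁ (strictlyInverseˡ pointMap (line x x≉0))

  ∉⇒¬LiesOn : ∀ {x} x≉0 {B} → x ∉ Span (hyperplane B) → ¬ LiesOn (point x x≉0) B
  ∉⇒¬LiesOn {x} x≉0 x∉B p⊆B = x∉B (p⊆B (proj₂ (strictlyInverseˡ pointMap (line x x≉0)) (∈-line x)))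

  -- The two dimensions add up to more than `a`. This fails for `a` equal to 2, where hyperplanes
  -- are points and distinct ones are disjoint.
  common-point : ∀ B C → ∃[ p ] (LiesOn p B × LiesOn p C)
  common-point B C =
    let (x , x≉0 , x∈B , x∈C) = inside-both (3≤a⇒a<[a∸1]+[a∸1] 3≤a)
                                  (independent (to partMap B)) (independent (to partMap C))
    in point x x≉0 , ∈⇒LiesOn x≉0 {B} x∈B , ∈⇒LiesOn x≉0 {C} x∈C

  missed-point : ∀ B C → ∃[ p ] (¬ LiesOn p B × ¬ LiesOn p C)
  missed-point B C =
    let (x , x∉B , x∉C) = outside-both (0<a⇒a∸1<a (ℕ.m<n⇒0<n 3≤a)) (hyperplane B) (hyperplane C)
        x≉0             = ∉-Span⇒≉0 (hyperplane B) x∉B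
    in point x x≉0 , ∉⇒¬LiesOn x≉0 {B} x∉B , ∉⇒¬LiesOn x≉0 {C} x∉C

  blocks-intersect : IsPairwiseTransitive {D} G → ∀ B C → Intersecting B C
  blocks-intersect transitive B C =
    let (p , p∈B , p∈C)    = common-point B C
        (p′ , p′∉B , p′∉C) = missed-point B C
    in [ (λ lies⇒I → p , lies⇒I p∈B , lies⇒I p∈C)
       , (λ misses⇒I → p′ , misses⇒I p′∉B , misses⇒I p′∉C)
       ] (invariant⇒incidence-or-complement G transitive LiesOn
            -- The two points already found, paired with `B`, show that `LiesOn` is neither empty
            -- nor full.
            (λ g {p} {B} → LiesOn-invariant g {p} {B}) (p , B , p∈B) (p′ , B , p′∉B))

lemma4p13 : (D : Design) (k ƛ : ℕ) → Design.Is2Design D k ƛ → 2 < k → k < Design.v D →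
    (G : Subgroup (Design.Aut D)) → IsPairwiseTransitive {D} G →
    IsAlmostSimple (inducedGroup (onPoints {D} G)) →
    HasRank (onBlocks {D} G) 3 →
    (S : SystemOfImprimitivity (onBlocks {D} G)) →
    SystemOfImprimitivity.IsNontrivialSystem S →
    ¬ (∃[ a ] ∃[ q ] (3 ≤ a × IsPrimePower q ×
    (Σ[ F ∈ FiniteField q ]
    ArePointHyperplaneActions {D} G S a (FiniteField.heytingField F))))
-- The base point `B` of the rank hypothesis ensures that there is a block; on an empty block set,
-- nontriviality of `S` would hold vacuously.
lemma4p13 D _ _ _ _ _ G transitive _ (_ , B , _) S nontrivial (_ , _ , 3≤a , _ , F , actions) =
  pairwise-intersecting⇒systems-trivial G transitive (blocks-intersect 3≤a F actions transitive) B S nontrivial
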